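{- Let $n,m$ be integers with $n\geq 2$ and $m\geq 6n$. Then $K_{2n+1}^{\star m}\notin\mathfrak{N}_{c}$.
   Context: All graphs are finite, undirected, without loops or multiple edges. Let $K_{2n+1}$ be the complete graph with vertex set $\{v_{1},\ldots,v_{2n+1}\}$. For positive integers $m,n$, the graph $K_{2n+1}^{\star m}$ is defined by $V(K_{2n+1}^{\star m})=V(K_{2n+1})\cup\{u,w_{1},\ldots,w_{m}\}$ (with $u,w_1,\ldots,w_m$ new distinct vertices) and $E(K_{2n+1}^{\star m})=E(K_{2n+1})\cup\{v_{1}u\}\cup\{uw_{i}: 1\leq i\leq m\}$. For a positive integer $t$, an interval cyclic $t$-coloring of a graph $G$ is a proper edge-coloring of $G$ with colors $1,\ldots,t$ such that all $t$ colors are used and, for each vertex $v$, the edges incident to $v$ are colored by $d_{G}(v)$ consecutive colors modulo $t$ (i.e. consecutive in the cyclic order $1,2,\ldots,t,1$), where $d_G(v)$ is the degree of $v$. $\mathfrak{N}_{c}$ is the set of graphs having an interval cyclic $t$-coloring for some positive integer $t$. -}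

module Defs where

open import Data.Empty using (⊥)
open import Data.Fin using (Fin; zero; suc; toℕ)
open import Data.Fin.Properties using (_≟_; inj⇒≟; +↔⊎)
open import Data.List using (List; length; filter; map; allFin)
open import Data.Nat using (ℕ; suc; _+_; _*_; _<_; NonZero)
open import Data.Nat.DivMod using (_%_)
open import Data.Product using (∃-syntax; Σ-syntax; _×_; _,_; proj₁; proj₂)
open import Data.Sum using (_⊎_; inj₁; inj₂)
open import Data.Sum.Function.Propositional using (_⊎-↔_)
open import Data.Unit using (⊤; tt)
open import Function.Base using (_∘_)
open import Function.Bundles using (_↔_; _⇔_; Inverse)
open import Function.Construct.Composition using (_↔-∘_)
open import Function.Construct.Identity using (↔-id)
open import Function.Construct.Symmetry using (↔-sym)
open import Function.Properties.Inverse using (↔⇒↣)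
open import Level using (0ℓ)
open import Relation.Binary.Core using (Rel)
open import Relation.Binary.Definitions using (Decidable; DecidableEquality; Symmetric; Irreflexive)
open import Relation.Binary.PropositionalEquality using (_≡_; _≢_; refl; sym)
open import Relation.Nullary.Decidable using (yes; no; ¬?)

record Graph : Set₁ where
  field
    V      : Set
    finite : ∃[ k ] (V ↔ Fin k)
    Adj    : Rel V 0ℓ
    adj?   : Decidable Adj
    symm   : Symmetric Adj
    irrefl : Irreflexive _≡_ Adj

  vertices : List V
  vertices = map (Inverse.from (proj₂ finite)) (allFin (proj₁ finite))

  degree : V → ℕ
  degree x = length (filter (adj? x) vertices)

  _≟ᵛ_ : DecidableEquality V
  _≟ᵛ_ = inj⇒≟ (↔⇒↣ (proj₂ finite))

complete : ℕ → Graph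
complete k = record
  { V      = Fin k
  ; finite = k , ↔-id (Fin k)
  ; Adj    = _≢_
  ; adj?   = λ i j → ¬? (i ≟ j)
  ; symm   = λ i≢j → i≢j ∘ sym
  ; irrefl = λ i≡j i≢j → i≢j i≡j
  }

pattern old x = inj₁ x
pattern u     = inj₂ zero
pattern w i   = inj₂ (suc i)

-- G with new vertices u, w₁, …, wₘ and new edges au, uw₁, …, uwₘ.
attachStar : (G : Graph) → Graph.V G → ℕ → Graph
attachStar G a m = record
  { V      = Vertex
  ; finite = proj₁ G.finite + suc m
           , ↔-sym +↔⊎ ↔-∘ (proj₂ G.finite ⊎-↔ ↔-id (Fin (suc m)))
  ; Adj    = _~_
  ; adj?   = _~?_
  ; symm   = λ {x} {y} → ~-sym x y
  ; irrefl = λ { {x} refl → ~-irrefl x }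
  }
  where
  module G = Graph G

  Vertex : Set
  Vertex = G.V ⊎ Fin (suc m)

  _~_ : Rel Vertex 0ℓ
  old x ~ old y = G.Adj x y
  old x ~ u     = x ≡ a
  old _ ~ w _   = ⊥
  u     ~ old y = y ≡ a
  u     ~ u     = ⊥
  u     ~ w _   = ⊤
  w _   ~ old _ = ⊥
  w _   ~ u     = ⊤
  w _   ~ w _   = ⊥

  _~?_ : Decidable _~_
  old x ~? old y = G.adj? x y
  old x ~? u     = x G.≟ᵛ a
  old _ ~? w _   = no λ ()
  u     ~? old y = y G.≟ᵛ a
  u     ~? u     = no λ ()
  u     ~? w _   = yes tt
  w _   ~? old _ = no λ ()
  w _   ~? u     = yes tt
  w _   ~? w _   = no λ ()

  ~-sym : ∀ x y → x ~ y → y ~ x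
  ~-sym (old _) (old _) p = G.symm p
  ~-sym (old _) u       p = p
  ~-sym u       (old _) p = p
  ~-sym u       (w _)   p = p
  ~-sym (w _)   u       p = p

  ~-irrefl : ∀ x → x ~ x → ⊥
  ~-irrefl (old _) p  = G.irrefl refl p
  ~-irrefl u       ()
  ~-irrefl (w _)   ()

K⋆ : ℕ → ℕ → Graph
K⋆ n m = attachStar (complete (suc (2 * n))) zero m

module _ (G : Graph) where
  open Graph G

  -- The colour i : Fin t stands for the colour i + 1 of {1, …, t}.
  record IntervalCyclicColouring (t : ℕ) .{{_ : NonZero t}} : Set where
    field
      colour : ∀ {x y} → Adj x y → Fin t

      -- Well defined on undirected edges; since p and q are arbitrary, the
      -- colour also does not depend on the proof of adjacency.
      undirected : ∀ {x y} (p : Adj x y) (q : Adj y x) → colour p ≡ colour q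

      proper : ∀ {x y z} (p : Adj x y) (q : Adj x z) → colour p ≡ colour q → y ≡ z

      allUsed : ∀ c → ∃[ x ] ∃[ y ] ∃[ p ] colour {x} {y} p ≡ c

      -- The colours at x are exactly s, s + 1, …, s + degree x - 1 modulo t.
      consecutive : ∀ x → Σ[ s ∈ ℕ ] ∀ (c : Fin t) →
        (∃[ y ] ∃[ p ] colour {x} {y} p ≡ c) ⇔
        (∃[ i ] i < degree x × toℕ c ≡ (s + i) % t)

𝔑c : Graph → Set
𝔑c G = ∃[ t ] Σ[ t>0 ∈ NonZero t ] IntervalCyclicColouring G t {{t>0}}

{-# OPTIONS --safe #-}
module Submission where

-- Write D = 2n, so that v₁ has degree D + 1 and every other vertex of the
-- complete graph has degree D.  The edges u wᵢ have pairwise different colours,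
-- hence t ≥ m ≥ 3D.  This makes the cyclic structure of the colours irrelevant
-- on the complete graph: rotate the colours so that those at v₁ become
-- D, D + 1, …, 2D.  A vertex x ≠ v₁ of the complete graph sees an interval of D
-- colours containing the colour of x v₁, so after the rotation its colours lie
-- in [0, 3D) and form a genuine interval of D integers (`interval-other`).
--
-- Now reduce the rotated colours modulo D.  Each x ≠ v₁ sees every residue
-- exactly once, and v₁ sees every residue other than 0 exactly once.  Since
-- D ≥ 3, one of the residues 1 and 2 is not that of the pendant edge v₁u.  The
-- edges of the complete graph whose rotated colour has this residue form a
-- perfect matching of its D + 1 vertices (`matched-exists`, `matched-unique`),
-- so D + 1 is even (`involution⇒even`), whereas D = 2n.

open import Defs
open import Data.Fin using (Fin; zero; suc; toℕ; fromℕ<; punchIn; punchOut) renaming (_<_ to _<ᶠ_)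
import Data.Fin.Properties as Fin
open import Data.List using (List; length; filter; map; allFin; tabulate; _++_)
open import Data.List.Properties using (length-++; length-map; length-tabulate)
open import Data.List.Membership.Propositional using (_∈_)
open import Data.List.Membership.Propositional.Properties
  using (∈-map⁺; ∈-map⁻; ∈-filter⁺; ∈-filter⁻; ∈-allFin; ∈-tabulate⁺; ∈-tabulate⁻; ∈-++⁺ˡ; ∈-++⁺ʳ)
open import Data.List.Membership.Propositional.Properties.WithK using (unique∧set⇒bag)
open import Data.List.Relation.Binary.BagAndSetEquality using (∼bag⇒↭)
open import Data.List.Relation.Binary.Permutation.Propositional.Properties using (↭-length)
open import Data.List.Relation.Unary.Unique.Propositional using (Unique)
import Data.List.Relation.Unary.Unique.Propositional.Properties as Unique
open import Data.Nat
  using (ℕ; suc; pred; _+_; _*_; _∸_; _≤_; _<_; _≥_; z≤n; s≤s; z<s; NonZero; >-nonZero)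
open import Data.Nat.Divisibility using (_∣_; divides)
open import Data.Nat.DivMod
open import Data.Nat.Properties
open import Data.Nat.Solver using (module +-*-Solver)
open import Data.Product using (∃-syntax; _×_; _,_; proj₁; proj₂)
open import Data.Sum using (inj₁; inj₂)
open import Data.Sum.Properties using (inj₁-injective; inj₂-injective)
open import Data.Unit using (tt)
open import Function.Base using (_∘_)
open import Function.Bundles using (Equivalence; Inverse; mk⇔)
open import Relation.Binary.Definitions using (tri<; tri≈; tri>)
open import Relation.Binary.PropositionalEquality
open import Relation.Nullary using (¬_; yes; no; contradiction)
open import Relation.Unary using (_∉_)

-- Counting with duplicate-free lists

unique-length : ∀ {A : Set} {xs ys : List A} → Unique xs → Unique ys →
                (∀ {z} → z ∈ xs → z ∈ ys) → (∀ {z} → z ∈ ys → z ∈ xs) →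
                length xs ≡ length ys
unique-length xs! ys! xs⊆ys ys⊆xs =
  ↭-length (∼bag⇒↭ (unique∧set⇒bag xs! ys! (mk⇔ xs⊆ys ys⊆xs)))

-- A fixed-point-free involution pairs each x with x < f x to its image.
involution⇒even : ∀ {k} (f : Fin k → Fin k) → (∀ x → f (f x) ≡ x) → (∀ x → f x ≢ x) →
                  ∃[ l ] k ≡ 2 * l
involution⇒even {k} f f∘f f≢ = length A , (begin
  k                            ≡⟨ length-tabulate {n = k} (λ x → x) ⟨
  length (allFin k)            ≡⟨ unique-length (Unique.allFin⁺ k) both! (λ {z} _ → complete-both z) (λ _ → ∈-allFin _) ⟩
  length (A ++ map f A)        ≡⟨ length-++ A ⟩
  length A + length (map f A)  ≡⟨ cong (length A +_) (length-map f A) ⟩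
  length A + length A          ≡⟨ cong (length A +_) (+-identityʳ (length A)) ⟨
  2 * length A                 ∎)
  where
  open ≡-Reasoning

  up? = λ x → x Fin.<? f x
  A = filter up? (allFin k)

  A! : Unique A
  A! = Unique.filter⁺ up? (Unique.allFin⁺ k)

  f-injective : ∀ {x y} → f x ≡ f y → x ≡ y
  f-injective {x} {y} eq = trans (sym (f∘f x)) (trans (cong f eq) (f∘f y))

  disjoint : ∀ {z} → ¬ (z ∈ A × z ∈ map f A)
  disjoint (z∈A , z∈fA) with ∈-map⁻ f z∈fA
  ... | x , x∈A , refl = Fin.<-asym (proj₂ (∈-filter⁻ up? {xs = allFin k} x∈A))
          (subst (f x <ᶠ_) (f∘f x) (proj₂ (∈-filter⁻ up? {xs = allFin k} z∈A)))

  both! : Unique (A ++ map f A)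
  both! = Unique.++⁺ A! (Unique.map⁺ f-injective A!) disjoint

  complete-both : ∀ z → z ∈ A ++ map f A
  complete-both z with Fin.<-cmp z (f z)
  ... | tri< z<fz _ _ = ∈-++⁺ˡ (∈-filter⁺ up? (∈-allFin z) z<fz)
  ... | tri≈ _ z≡fz _ = contradiction (sym z≡fz) (f≢ z)
  ... | tri> _ _ fz<z = ∈-++⁺ʳ A (subst (_∈ map f A) (f∘f z) (∈-map⁺ f
          (∈-filter⁺ up? (∈-allFin (f z)) (subst (f z <ᶠ_) (sym (f∘f z)) fz<z))))

module _ (G : Graph) where
  open Graph G

  -- An injective enumeration of the neighbours of x by Fin k computes its degree.
  degree-enumeration : ∀ {k x} (f : Fin k → V) → (∀ {i j} → f i ≡ f j → i ≡ j) →
                       (∀ i → Adj x (f i)) → (∀ {y} → Adj x y → ∃[ i ] y ≡ f i) →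
                       degree x ≡ k
  degree-enumeration {k} {x} f f-inj f-adj f-onto = trans
    (unique-length
      (Unique.filter⁺ (adj? x) (Unique.map⁺ from-injective (Unique.allFin⁺ (proj₁ finite))))
      (Unique.tabulate⁺ f-inj)
      (λ z∈ → let i , z≡fi = f-onto (proj₂ (∈-filter⁻ (adj? x) {xs = vertices} z∈))
              in subst (_∈ tabulate f) (sym z≡fi) (∈-tabulate⁺ i))
      (λ z∈ → let i , z≡fi = ∈-tabulate⁻ {f = f} z∈
              in ∈-filter⁺ (adj? x) (∈-vertices _) (subst (Adj x) (sym z≡fi) (f-adj i))))
    (length-tabulate f)
    where
    open Inverse (proj₂ finite)

    from-injective : ∀ {i j} → from i ≡ from j → i ≡ j
    from-injective {i} {j} eq =
      trans (sym (strictlyInverseˡ i)) (trans (cong to eq) (strictlyInverseˡ j))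

    ∈-vertices : ∀ y → y ∈ vertices
    ∈-vertices y = subst (_∈ vertices) (strictlyInverseʳ y) (∈-map⁺ from (∈-allFin (to y)))

-- Residues

module _ (d : ℕ) .{{_ : NonZero d}} where

  -- The witness represents -a modulo d.
  negation-% : ∀ a → ∃[ a′ ] d ∣ a + a′
  negation-% a = pred d * a , divides a (trans (cong (_* a) (suc-pred d)) (*-comm d a))

  %-congʳ-+ : ∀ {a b} c → a % d ≡ b % d → (a + c) % d ≡ (b + c) % d
  %-congʳ-+ {a} {b} c eq = begin
    (a + c) % d          ≡⟨ %-distribˡ-+ a c d ⟩
    (a % d + c % d) % d  ≡⟨ cong (λ r → (r + c % d) % d) eq ⟩
    (b % d + c % d) % d  ≡⟨ %-distribˡ-+ b c d ⟨
    (b + c) % d          ∎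
    where open ≡-Reasoning

  %-cancelʳ-+ : ∀ {a b} c → (a + c) % d ≡ (b + c) % d → a % d ≡ b % d
  %-cancelʳ-+ {a} {b} c eq = trans (sym (undo a)) (trans (%-congʳ-+ c′ eq) (undo b))
    where
    c′ = proj₁ (negation-% c)

    undo : ∀ e → (e + c + c′) % d ≡ e % d
    undo e = trans (cong (_% d) (+-assoc e c c′)) (%-remove-+ʳ e (proj₂ (negation-% c)))

  residue-exists : ∀ S {r} → r < d → ∃[ i ] i < d × (S + i) % d ≡ r
  residue-exists S {r} r<d = (S′ + r) % d , m%n<n (S′ + r) d , (begin
    (S + (S′ + r) % d) % d  ≡⟨ cong (_% d) (+-comm S _) ⟩
    ((S′ + r) % d + S) % d  ≡⟨ %-congʳ-+ S (m%n%n≡m%n (S′ + r) d) ⟩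
    (S′ + r + S) % d        ≡⟨ cong (_% d) (+-comm (S′ + r) S) ⟩
    (S + (S′ + r)) % d      ≡⟨ cong (_% d) (+-assoc S S′ r) ⟨
    (S + S′ + r) % d        ≡⟨ %-remove-+ˡ r (proj₂ (negation-% S)) ⟩
    r % d                   ≡⟨ m<n⇒m%n≡m r<d ⟩
    r                       ∎)
    where
    open ≡-Reasoning
    S′ = proj₁ (negation-% S)

  residue-unique : ∀ S {i j} → i < d → j < d → (S + i) % d ≡ (S + j) % d → i ≡ j
  residue-unique S {i} {j} i<d j<d eq = begin
    i      ≡⟨ m<n⇒m%n≡m i<d ⟨
    i % d  ≡⟨ %-cancelʳ-+ S (trans (cong (_% d) (+-comm i S)) (trans eq (cong (_% d) (+-comm S j)))) ⟩
    j % d  ≡⟨ m<n⇒m%n≡m j<d ⟩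
    j      ∎
    where open ≡-Reasoning

-- Rotating the colours

module Rotation (G : Graph) (t : ℕ) .{{_ : NonZero t}} (C : IntervalCyclicColouring G t) (K : ℕ) where
  open Graph G
  open IntervalCyclicColouring C

  -- The first of the consecutive colours at a vertex, up to multiples of t.
  first : V → ℕ
  first x = proj₁ (consecutive x)

  -- The colour of an edge after rotating the t colours by K steps.
  rotated : ∀ {x y} → Adj x y → ℕ
  rotated p = (toℕ (colour p) + K) % t

  rotated-undirected : ∀ {x y} (p : Adj x y) (q : Adj y x) → rotated p ≡ rotated q
  rotated-undirected p q = cong (λ c → (toℕ c + K) % t) (undirected p q)

  rotated-proper : ∀ {x y z} (p : Adj x y) (q : Adj x z) → rotated p ≡ rotated q → y ≡ z
  rotated-proper p q eq = proper p q (Fin.toℕ-injective (begin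
    toℕ (colour p)      ≡⟨ m<n⇒m%n≡m (Fin.toℕ<n (colour p)) ⟨
    toℕ (colour p) % t  ≡⟨ %-cancelʳ-+ t K eq ⟩
    toℕ (colour q) % t  ≡⟨ m<n⇒m%n≡m (Fin.toℕ<n (colour q)) ⟩
    toℕ (colour q)      ∎))
    where open ≡-Reasoning

  -- The rotated colours at x are exactly the integers S, …, S + degree x - 1,
  -- without any reduction modulo t.
  record IntervalAt (x : V) (S : ℕ) : Set where
    field
      index   : ∀ {y} (p : Adj x y) → ∃[ i ] i < degree x × rotated p ≡ S + i
      realise : ∀ {i} → i < degree x → ∃[ y ] ∃[ p ] rotated {x} {y} p ≡ S + i

  rotate-index : ∀ x i → ((first x + i) % t + K) % t ≡ (first x + K + i) % t
  rotate-index x i = begin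
    ((first x + i) % t + K) % t  ≡⟨ %-congʳ-+ t K (m%n%n≡m%n (first x + i) t) ⟩
    (first x + i + K) % t        ≡⟨ cong (_% t) (+-assoc (first x) i K) ⟩
    (first x + (i + K)) % t      ≡⟨ cong (λ e → (first x + e) % t) (+-comm i K) ⟩
    (first x + (K + i)) % t      ≡⟨ cong (_% t) (+-assoc (first x) K i) ⟨
    (first x + K + i) % t        ∎
    where open ≡-Reasoning

  offset : ∀ {x y} (p : Adj x y) → ∃[ i ] i < degree x × rotated p ≡ (first x + K + i) % t
  offset {x} p with Equivalence.to (proj₂ (consecutive x) (colour p)) (_ , p , refl)
  ... | i , i<deg , eq = i , i<deg , trans (cong (λ c → (c + K) % t) eq) (rotate-index x i)

  -- If the rotated start is S modulo t and S, …, S + degree x - 1 all lie below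
  -- t, then reduction modulo t does nothing.
  no-wraparound : ∀ {x S} → (first x + K) % t ≡ S % t → S + degree x ≤ t → IntervalAt x S
  no-wraparound {x} {S} S≡ S≤ = record { index = index ; realise = realise }
    where
    open ≡-Reasoning

    reduce : ∀ {i} → i < degree x → (first x + K + i) % t ≡ S + i
    reduce {i} i<deg = trans (%-congʳ-+ t i S≡) (m<n⇒m%n≡m (<-≤-trans (+-monoʳ-< S i<deg) S≤))

    index : ∀ {y} (p : Adj x y) → ∃[ i ] i < degree x × rotated p ≡ S + i
    index p with offset p
    ... | i , i<deg , eq = i , i<deg , trans eq (reduce i<deg)

    colour-at : ℕ → Fin t
    colour-at i = fromℕ< (m%n<n (first x + i) t)

    realise : ∀ {i} → i < degree x → ∃[ y ] ∃[ p ] rotated {x} {y} p ≡ S + i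
    realise {i} i<deg
      with Equivalence.from (proj₂ (consecutive x) (colour-at i)) (i , i<deg , Fin.toℕ-fromℕ< _)
    ... | y , p , eq = y , p , (begin
      (toℕ (colour p) + K) % t       ≡⟨ cong (λ c → (toℕ c + K) % t) eq ⟩
      (toℕ (colour-at i) + K) % t    ≡⟨ cong (λ e → (e + K) % t) (Fin.toℕ-fromℕ< _) ⟩
      ((first x + i) % t + K) % t    ≡⟨ rotate-index x i ⟩
      (first x + K + i) % t          ≡⟨ reduce i<deg ⟩
      S + i                          ∎)

-- Complete graphs with a star attached

-- The complete graph has D + 1 vertices, of which zero is v₁; D may be odd.
module Star (D m : ℕ) where

  G : Graph
  G = attachStar (complete (suc D)) zero m

  open Graph G

  degree-v₁ : degree (old zero) ≡ suc D
  degree-v₁ = degree-enumeration G {x = old zero} f f-injective f-adj f-onto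
    where
    f : Fin (suc D) → V
    f zero    = u
    f (suc i) = old (suc i)

    f-injective : ∀ {i j} → f i ≡ f j → i ≡ j
    f-injective {zero}  {zero}  _  = refl
    f-injective {suc i} {suc j} eq = inj₁-injective eq

    f-adj : ∀ i → Adj (old zero) (f i)
    f-adj zero    = refl
    f-adj (suc i) = λ ()

    f-onto : ∀ {y} → Adj (old zero) y → ∃[ i ] y ≡ f i
    f-onto {old zero}    p = contradiction refl p
    f-onto {old (suc i)} _ = suc i , refl
    f-onto {u}           _ = zero , refl

  degree-other : ∀ j → degree (old (suc j)) ≡ D
  degree-other j = degree-enumeration G {x = old (suc j)} (old ∘ punchIn (suc j))
    (λ eq → Fin.punchIn-injective (suc j) _ _ (inj₁-injective eq))
    (λ i eq → Fin.punchInᵢ≢i (suc j) i (sym eq))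
    onto
    where
    onto : ∀ {y} → Adj (old (suc j)) y → ∃[ i ] y ≡ old (punchIn (suc j) i)
    onto {old k} p = punchOut p , cong old (sym (Fin.punchIn-punchOut p))
    onto {u}     ()

  module _ (t : ℕ) .{{_ : NonZero t}} (C : IntervalCyclicColouring G t) where
    open IntervalCyclicColouring C

    leaves≤colours : m ≤ t
    leaves≤colours = Fin.injective⇒≤ {f = λ i → colour {u} {w i} tt}
      (λ eq → Fin.suc-injective (inj₂-injective (proper tt tt eq)))

    module _ (3≤D : 3 ≤ D) (3D≤t : D + D + D ≤ t) where

      private instance
        D-nonZero : NonZero D
        D-nonZero = >-nonZero (≤-trans (s≤s z≤n) 3≤D)

      -- D minus the first colour at v₁, modulo t: rotating by K turns that colour
      -- into D.
      K : ℕ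
      K = proj₁ (negation-% t (proj₁ (consecutive (old zero)))) + D

      open Rotation G t C K

      interval-v₁ : IntervalAt (old zero) D
      interval-v₁ = no-wraparound
        (trans (cong (_% t) (sym (+-assoc (first (old zero)) _ D)))
               (%-remove-+ˡ D (proj₂ (negation-% t (first (old zero))))))
        (begin
          D + degree (old zero)  ≡⟨ cong (D +_) degree-v₁ ⟩
          D + suc D              ≡⟨ +-suc D D ⟩
          suc (D + D)            ≤⟨ s≤s (m≤m+n (D + D) (pred D)) ⟩
          suc (D + D + pred D)   ≡⟨ +-suc (D + D) (pred D) ⟨
          D + D + suc (pred D)   ≡⟨ cong (D + D +_) (suc-pred D) ⟩
          D + D + D              ≤⟨ 3D≤t ⟩
          t                      ∎)
        where open ≤-Reasoning

      -- If the edge from x to v₁ has rotated colour D + a and is number b (from 0)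
      -- at x, then the interval at x starts at D + a - b.  This is at least 0
      -- because b < D and at most 2D because a ≤ D, so the interval stays
      -- below 3D ≤ t.
      interval-other : ∀ j → ∃[ S ] IntervalAt (old (suc j)) S
      interval-other j
        with offset {old (suc j)} {old zero} (λ ())
           | IntervalAt.index interval-v₁ {old (suc j)} (λ ())
      ... | b , b<deg , eqb | a , a<deg , eqa = S , no-wraparound S≡ S≤
        where
        S = D + a ∸ b

        b<D : b < D
        b<D = subst (b <_) (degree-other j) b<deg

        a≤D : a ≤ D
        a≤D = m<1+n⇒m≤n (subst (a <_) degree-v₁ a<deg)

        b≤D+a : b ≤ D + a
        b≤D+a = ≤-trans (<⇒≤ b<D) (m≤m+n D a)

        rot : (first (old (suc j)) + K + b) % t ≡ D + a
        rot = trans (sym eqb) (trans (rotated-undirected {old (suc j)} {old zero} (λ ()) (λ ())) eqa)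

        D+a<t : D + a < t
        D+a<t = subst (_< t) rot (m%n<n _ t)

        S≡ : (first (old (suc j)) + K) % t ≡ S % t
        S≡ = %-cancelʳ-+ t b (begin
          (first (old (suc j)) + K + b) % t  ≡⟨ rot ⟩
          D + a                              ≡⟨ m<n⇒m%n≡m D+a<t ⟨
          (D + a) % t                        ≡⟨ cong (_% t) (m∸n+n≡m b≤D+a) ⟨
          (S + b) % t                        ∎)
          where open ≡-Reasoning

        S≤ : S + degree (old (suc j)) ≤ t
        S≤ = begin
          S + degree (old (suc j))  ≡⟨ cong (S +_) (degree-other j) ⟩
          S + D                     ≤⟨ +-monoˡ-≤ D (m∸n≤m (D + a) b) ⟩
          D + a + D                 ≤⟨ +-monoˡ-≤ D (+-monoʳ-≤ D a≤D) ⟩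
          D + D + D                 ≤⟨ 3D≤t ⟩
          t                         ∎
          where open ≤-Reasoning

      -- A residue r other than 0 such that v₁u does not have rotated colour D + r.
      free-residue : ∃[ r ] 0 < r × r < D × rotated {old zero} {u} refl ≢ D + r
      free-residue with rotated {old zero} {u} refl ≟ D + 1
      ... | no  ≢D+1 = 1 , z<s , ≤-trans (n≤1+n 2) 3≤D , ≢D+1
      ... | yes ≡D+1 = 2 , z<s , 3≤D ,
        λ ≡D+2 → contradiction (+-cancelˡ-≡ D 1 2 (trans (sym ≡D+1) ≡D+2)) λ ()

      r : ℕ
      r = proj₁ free-residue

      r<D : r < D
      r<D = proj₁ (proj₂ (proj₂ free-residue))

      -- The edges of the complete graph whose rotated colour is r modulo D.
      Matched : Fin (suc D) → Fin (suc D) → Set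
      Matched x y = ∃[ p ] rotated {old x} {old y} p % D ≡ r

      matched-sym : ∀ {x y} → Matched x y → Matched y x
      matched-sym {x} {y} (p , eq) =
        p ∘ sym , trans (cong (_% D) (rotated-undirected {old y} {old x} (p ∘ sym) p)) eq

      matched-exists : ∀ x → ∃[ y ] Matched x y
      matched-exists zero
        with IntervalAt.realise interval-v₁
               (subst (r <_) (sym degree-v₁) (m<n⇒m<1+n r<D))
      ... | old y , p , eq = y , p , (begin
        rotated {old zero} {old y} p % D  ≡⟨ cong (_% D) eq ⟩
        (D + r) % D                       ≡⟨ cong (_% D) (+-comm D r) ⟩
        (r + D) % D                       ≡⟨ [m+n]%n≡m%n r D ⟩
        r % D                             ≡⟨ m<n⇒m%n≡m r<D ⟩
        r                                 ∎)
        where open ≡-Reasoning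
      ... | u , refl , eq = contradiction eq (proj₂ (proj₂ (proj₂ free-residue)))
      matched-exists (suc j) with interval-other j
      ... | S , at-x with residue-exists D S r<D
      ... | i , i<D , S+i≡r
        with IntervalAt.realise at-x (subst (i <_) (sym (degree-other j)) i<D)
      ... | old y , p , eq = y , p , trans (cong (_% D) eq) S+i≡r
      ... | u , () , _
      ... | w _ , () , _

      matched-unique : ∀ x {y z} → Matched x y → Matched x z → y ≡ z
      matched-unique zero {y} {z} (p , p≡r) (q , q≡r) =
        inj₁-injective (rotated-proper {old zero} {old y} {old z} p q
          (trans (at-D+r y p p≡r) (sym (at-D+r z q q≡r))))
        where
        at-D+r : ∀ y p → rotated {old zero} {old y} p % D ≡ r → rotated {old zero} {old y} p ≡ D + r
        at-D+r y p eq with IntervalAt.index interval-v₁ {old y} p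
        ... | i , i<deg , rot = trans rot (cong (D +_) i≡r)
          where
          open ≡-Reasoning

          i%D≡r : i % D ≡ r
          i%D≡r = begin
            i % D                             ≡⟨ [m+n]%n≡m%n i D ⟨
            (i + D) % D                       ≡⟨ cong (_% D) (+-comm i D) ⟩
            (D + i) % D                       ≡⟨ cong (_% D) rot ⟨
            rotated {old zero} {old y} p % D  ≡⟨ eq ⟩
            r                                 ∎

          i≡r : i ≡ r
          i≡r with m≤n⇒m<n∨m≡n (m<1+n⇒m≤n (subst (i <_) degree-v₁ i<deg))
          ... | inj₁ i<D = trans (sym (m<n⇒m%n≡m i<D)) i%D≡r
          -- The last index D at v₁ has residue 0, and r > 0.
          ... | inj₂ refl = contradiction (trans (sym i%D≡r) (n%n≡0 D))
                              (≢-sym (<⇒≢ (proj₁ (proj₂ free-residue))))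
      matched-unique (suc j) {y} {z} (p , p≡r) (q , q≡r) with interval-other j
      ... | S , at-x
        with IntervalAt.index at-x {old y} p | IntervalAt.index at-x {old z} q
      ... | i , i<deg , rot-p | k , k<deg , rot-q =
        inj₁-injective (rotated-proper {old (suc j)} {old y} {old z} p q
          (trans rot-p (trans (cong (S +_) i≡k) (sym rot-q))))
        where
        i≡k : i ≡ k
        i≡k = residue-unique D S
          (subst (i <_) (degree-other j) i<deg) (subst (k <_) (degree-other j) k<deg)
          (trans (cong (_% D) (sym rot-p)) (trans p≡r (trans (sym q≡r) (cong (_% D) rot-q))))

      colourable⇒even : ∃[ l ] suc D ≡ 2 * l
      colourable⇒even = involution⇒even partner
        (λ x → matched-unique (partner x) (matched (partner x)) (matched-sym (matched x)))
        (λ x eq → proj₁ (matched x) (sym eq))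
        where
        partner : Fin (suc D) → Fin (suc D)
        partner x = proj₁ (matched-exists x)

        matched : ∀ x → Matched x (partner x)
        matched x = proj₂ (matched-exists x)

theorem37 : (n m : ℕ) → n ≥ 2 → m ≥ 6 * n → K⋆ n m ∉ 𝔑c
theorem37 n m n≥2 m≥6n (t , t>0 , C) =
  let l , odd≡even = Star.colourable⇒even (2 * n) m t {{t>0}} C 3≤2n
                       (≤-trans 6n≤m (Star.leaves≤colours (2 * n) m t {{t>0}} C))
  in even≢odd l n (sym odd≡even)
  where
  3≤2n : 3 ≤ 2 * n
  3≤2n = ≤-trans (n≤1+n 3) (*-monoʳ-≤ 2 n≥2)

  6n≤m : 2 * n + 2 * n + 2 * n ≤ m
  6n≤m = subst (_≤ m) (solve 1 (λ k → con 6 :* k := con 2 :* k :+ con 2 :* k :+ con 2 :* k) refl n) m≥6n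
    where open +-*-Solver
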